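{- For every integer $k\ge 2$ and every positive integer $n$, $$(k-2)\left\lfloor\frac nk\right\rfloor\le \mathrm{co^+ex}(n,J_k)\le \frac{k-2}{k-1}\,n .$$
   Context: A $3$-graph is a finite $3$-uniform hypergraph. $J_k$ is the $3$-graph on $k+1$ vertices with a distinguished vertex $x$ whose $\binom k2$ edges are exactly the triples $\{x,u,v\}$ where $\{u,v\}$ ranges over all pairs of the other $k$ vertices. The minimum positive co-degree $\delta_2^+(H)$ of a non-empty $3$-graph $H$ is the maximum $m$ such that every pair of vertices contained in some edge of $H$ is contained in at least $m$ distinct edges of $H$; by convention it is $0$ if $H$ has no edges. A hypergraph is $F$-free if it has no (not necessarily induced) subhypergraph isomorphic to $F$. $\mathrm{co^+ex}(n,F)$ is the maximum of $\delta_2^+(H)$ over all $n$-vertex $F$-free $3$-graphs $H$. -}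

module Defs where

open import Data.Bool.Base using (Bool; false; T)
open import Data.Fin.Base using (Fin)
open import Data.Fin.Properties using (any?; _≟_)
open import Data.Fin.Subset using (Subset; inside; outside; ∣_∣; _∈_)
open import Data.Fin.Subset.Properties using (_∈?_)
open import Data.Nat.Base using (ℕ; suc; _∸_; _≤_; _≡ᵇ_; NonZero; NonTrivial)
open import Data.Nat.Properties using (≡ᵇ⇒≡)
open import Data.Product.Base using (∃; Σ-syntax; _×_)
open import Data.Vec.Base using (_∷_; tabulate)
open import Function.Definitions using (Injective)
open import Relation.Binary.PropositionalEquality using (_≡_; _≢_; cong)
open import Relation.Nullary using (¬_)
open import Relation.Nullary.Decidable using (⌊_⌋; _×-dec_)

record 3-Graph (n : ℕ) : Set where
  field
    isEdge  : Subset n → Bool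
    uniform : ∀ e → T (isEdge e) → ∣ e ∣ ≡ 3

  Edge : Subset n → Set
  Edge e = T (isEdge e)

open 3-Graph public using (Edge)

-- The distinguished vertex x is Fin.zero, so the edges are {x} ∪ p with p a
-- pair of the remaining k vertices.
J : ∀ k → 3-Graph (suc k)
J k = record { isEdge = isEdge ; uniform = uniform }
  where
  isEdge : Subset (suc k) → Bool
  isEdge (inside  ∷ p) = ∣ p ∣ ≡ᵇ 2
  isEdge (outside ∷ p) = false

  uniform : ∀ e → T (isEdge e) → ∣ e ∣ ≡ 3
  uniform (inside ∷ p) t = cong suc (≡ᵇ⇒≡ ∣ p ∣ 2 t)

image : ∀ {m n} → (Fin m → Fin n) → Subset m → Subset n
image f p = tabulate λ y → ⌊ any? (λ x → (x ∈? p) ×-dec (f x ≟ y)) ⌋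

-- A copy of F in H is an injection of vertices sending edges to edges; H may
-- have further edges on the image.
Contains : ∀ {m n} → 3-Graph n → 3-Graph m → Set
Contains {m} {n} H F =
  Σ[ f ∈ (Fin m → Fin n) ]
    Injective _≡_ _≡_ f × (∀ e → Edge F e → Edge H (image f e))

Free : ∀ {m n} → 3-Graph m → 3-Graph n → Set
Free F H = ¬ Contains H F

EdgeThrough : ∀ {n} → 3-Graph n → Fin n → Fin n → Subset n → Set
EdgeThrough H u v e = Edge H e × u ∈ e × v ∈ e

-- The pair {u , v} lies in at least m distinct edges.
CodegreeAtLeast : ∀ {n} → 3-Graph n → Fin n → Fin n → ℕ → Set
CodegreeAtLeast {n} H u v m =
  Σ[ es ∈ (Fin m → Subset n) ]
    Injective _≡_ _≡_ es × (∀ i → EdgeThrough H u v (es i))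

PositiveCodegreesAtLeast : ∀ {n} → 3-Graph n → ℕ → Set
PositiveCodegreesAtLeast H m =
  ∀ u v → u ≢ v → ∃ (EdgeThrough H u v) → CodegreeAtLeast H u v m

IsMaximum : (ℕ → Set) → ℕ → Set
IsMaximum P m = P m × (∀ m′ → P m′ → m′ ≤ m)

-- Isδ₂⁺ H m says that δ₂⁺(H) = m.
data Isδ₂⁺ {n} (H : 3-Graph n) : ℕ → Set where
  edgeless : (∀ e → ¬ Edge H e) → Isδ₂⁺ H 0
  nonempty : ∀ {m} → ∃ (Edge H) →
             IsMaximum (PositiveCodegreesAtLeast H) m → Isδ₂⁺ H m

-- IsCo⁺ex n F c says that the maximum co⁺ex(n, F) exists and equals c.
IsCo⁺ex : ∀ {m} → ℕ → 3-Graph m → ℕ → Set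
IsCo⁺ex n F = IsMaximum λ d → Σ[ H ∈ 3-Graph n ] Free F H × Isδ₂⁺ H d

nonTrivial⇒nonZero-∸1 : ∀ k .{{_ : NonTrivial k}} → NonZero (k ∸ 1)
nonTrivial⇒nonZero-∸1 (suc (suc k)) = _

{-# OPTIONS --safe #-}
-- Upper bound: let x lie in an edge and let d be the minimum positive
-- co-degree.  In the link of x every non-isolated vertex has at least d of the
-- n vertices as neighbours, so the common neighbourhood of j + 1 link vertices
-- has at least (j + 1) d − j n elements.  A clique of the link can therefore be
-- grown greedily, and it reaches size k, giving a copy of J k, unless
-- (k − 1) d ≤ (k − 2) n.
--
-- Lower bound: in the complete k-partite 3-graph with colour classes of size at
-- least ⌊n/k⌋, a pair contained in an edge extends into each of the k − 2
-- remaining classes, while a copy of J k would need k + 1 different colours.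
--
-- The maximum itself exists because all predicates involved are decidable and
-- the upper bound makes the possible values bounded.
module Submission where

open import Defs
open import Data.Bool.Base using (Bool; true; false; T; _∧_)
open import Data.Bool.Properties as Bool using (T-≡; T-∧)
open import Data.Fin.Base
  using (Fin; zero; suc; toℕ; inject≤; punchIn; punchOut; combine; remQuot)
open import Data.Fin.Properties as Fin
  using (any?; all?; _≟_; 0≢1+n; inject≤-injective; toℕ-inject≤; toℕ-injective;
         toℕ-fromℕ<; toℕ<n; toℕ-combine; combine-injectiveˡ; combine-remQuot; injective⇒≤;
         punchIn-injective; punchInᵢ≢i; punchIn-punchOut)
open import Data.Fin.Subset
  using (Subset; inside; outside; ∣_∣; _∈_; _∉_; _∪_; _∩_; _-_; ⁅_⁆; ⊥; Nonempty)
open import Data.Fin.Subset.Properties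
  using (_∈?_; anySubset?; nonempty?; Empty-unique; ∣⊥∣≡0; x∈⁅x⁆; x∈⁅y⁆⇒x≡y;
         ∣⁅x⁆∣≡1; ⊆-antisym; ∣p∣≤n; ∪-identityˡ; ∪-identityʳ; ∪-comm; ∪-assoc; ∪-idem;
         p⊆q⇒∣p∣≤∣q∣; x∈p∪q⁺; x∈p∪q⁻;
         x∈p∩q⁻; x∈p∧x≢y⇒x∈p-y; x∈p⇒∣p-x∣<∣p∣; p─q⊆p)
open import Data.Integer.Base as ℤ using (+_)
import Data.Integer.Properties as ℤ
open import Data.Nat.Base
  using (ℕ; zero; suc; _+_; _*_; _∸_; _≤_; z≤n; s≤s; s≤s⁻¹; _≡ᵇ_;
         NonZero; NonTrivial; nonTrivial⇒nonZero)
open import Data.Nat.DivMod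
  using (_/_; _%_; _mod_; m/n*n≤m; [m+kn]%n≡m%n; m<n⇒m%n≡m)
import Data.Nat.Properties as ℕ
open import Data.Product.Base using (Σ-syntax; ∃; _×_; _,_; proj₁; proj₂)
open import Data.Rational.Base as ℚ using ()
import Data.Rational.Properties as ℚ
import Data.Rational.Unnormalised.Base as ℚᵘ
import Data.Rational.Unnormalised.Properties as ℚᵘ
open import Data.Sum.Base using (_⊎_; inj₁; inj₂; [_,_])
open import Data.Vec.Base as Vec using ([]; _∷_; tabulate)
open import Data.Vec.Functional as Vector using (Vector)
open import Data.Vec.Properties
  using (lookup∘tabulate; []=⇒lookup; lookup⇒[]=; ≡-dec)
open import Function.Base using (_∘_)
open import Function.Bundles using (Equivalence)
open import Function.Definitions using (Injective)
open import Relation.Binary.Definitions using (DecidableEquality)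
open import Relation.Binary.PropositionalEquality
  using (_≡_; _≢_; _≗_; refl; sym; trans; cong; cong₂; subst; module ≡-Reasoning)
open import Relation.Nullary using (¬_; Dec; yes; no; contradiction)
open import Relation.Nullary.Decidable
  using (⌊_⌋; map′; _×-dec_; _→-dec_; _⊎-dec_; ¬?; T?; toWitness; fromWitness; decidable-stable)
open import Relation.Unary using (Decidable)

private
  variable
    k m n d : ℕ

-- Decidability of searches

-- Induction on `m`: search for the first value, then for the remaining ones. `resp` is required
-- because a function rebuilt from head and tail agrees with the original only pointwise.
any-function? : ∀ {A : Set} → (∀ {P : A → Set} → Decidable P → Dec (∃ P)) →
                ∀ m {P : Vector A m → Set} →
                (∀ {f g} → f ≗ g → P f → P g) → Decidable P → Dec (∃ P)
any-function? any-A? zero resp P? =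
  map′ (_ ,_) (λ (f , pf) → resp (λ ()) pf) (P? λ ())
any-function? {A} any-A? (suc m) {P} resp P? =
  map′ (λ (a , f , pf) → a Vector.∷ f , pf)
       (λ (f , pf) → f zero , f ∘ suc , resp (λ { zero → refl ; (suc i) → refl }) pf)
       (any-A? λ a → any-function? any-A? m (resp ∘ ∷-cong a) (P? ∘ (a Vector.∷_)))
  where
  ∷-cong : ∀ a {f g : Vector A m} → f ≗ g → (a Vector.∷ f) ≗ (a Vector.∷ g)
  ∷-cong a eq zero    = refl
  ∷-cong a eq (suc i) = eq i

-- A Boolean test on subsets of `suc n` points is a pair of tests on subsets of `n` points, one for
-- each status of the first point, so the search reduces to two nested smaller ones.
any-predicate? : ∀ n {P : (Subset n → Bool) → Set} →
                 (∀ {b c} → b ≗ c → P b → P c) → Decidable P → Dec (∃ P)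
any-predicate? zero {P} resp P? =
  map′ [ _ ,_ , _ ,_ ] (λ (b , pb) → split (b []) (resp (λ { [] → refl }) pb))
       (P? (λ _ → true) ⊎-dec P? (λ _ → false))
  where
  split : ∀ s → P (λ _ → s) → P (λ _ → true) ⊎ P (λ _ → false)
  split true  = inj₁
  split false = inj₂
any-predicate? (suc n) {P} resp P? =
  map′ (λ (b , c , p) → glue b c , p)
       (λ (b , pb) → b ∘ (inside ∷_) , b ∘ (outside ∷_) ,
                     resp (λ { (inside ∷ _) → refl ; (outside ∷ _) → refl }) pb)
       (any-predicate? n (λ eq (c , p) → c , resp (glue-cong eq λ _ → refl) p)
         λ b → any-predicate? n (resp ∘ glue-cong (λ _ → refl)) (P? ∘ glue b))
  where
  glue : (b c : Subset n → Bool) → Subset (suc n) → Bool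
  glue b c (inside  ∷ p) = b p
  glue b c (outside ∷ p) = c p

  glue-cong : ∀ {b b′ c c′} → b ≗ b′ → c ≗ c′ → glue b c ≗ glue b′ c′
  glue-cong b≗b′ c≗c′ (inside  ∷ p) = b≗b′ p
  glue-cong b≗b′ c≗c′ (outside ∷ p) = c≗c′ p

allSubset? : ∀ {P : Subset n → Set} → Decidable P → Dec (∀ p → P p)
allSubset? P? =
  map′ (λ ¬∃¬ p → decidable-stable (P? p) λ ¬p → ¬∃¬ (p , ¬p))
       (λ ∀p (p , ¬p) → ¬p (∀p p))
       (¬? (anySubset? (¬? ∘ P?)))

injective? : ∀ {A : Set} → DecidableEquality A →
             (f : Vector A m) → Dec (Injective _≡_ _≡_ f)
injective? _≟ᴬ_ f =
  map′ (λ inj → inj _ _) (λ inj i j → inj)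
       (all? λ i → all? λ j → (f i ≟ᴬ f j) →-dec (i ≟ j))

injective-resp-≗ : ∀ {A B : Set} {f g : A → B} → f ≗ g →
                   Injective _≡_ _≡_ f → Injective _≡_ _≡_ g
injective-resp-≗ f≗g inj {x} {y} eq = inj (trans (f≗g x) (trans eq (sym (f≗g y))))

-- Search downwards from the bound: if `P` fails at the top value, the bound drops by one.
maximum : ∀ {P : ℕ → Set} → Decidable P → P 0 →
          ∀ N → (∀ d → P d → d ≤ N) → ∃ (IsMaximum P)
maximum P? p₀ zero    bound = 0 , p₀ , bound
maximum P? p₀ (suc N) bound with P? (suc N)
... | yes p = suc N , p , bound
... | no ¬p = maximum P? p₀ N λ d pd →
      s≤s⁻¹ (ℕ.≤∧≢⇒< (bound d pd) λ { refl → ¬p pd })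

maximum-unique : ∀ {P : ℕ → Set} {c d} → IsMaximum P c → IsMaximum P d → c ≡ d
maximum-unique (pc , c-max) (pd , d-max) = ℕ.≤-antisym (d-max _ pc) (c-max _ pd)

-- Finite subsets

∈-tabulate⁺ : ∀ (b : Fin n → Bool) {x} → T (b x) → x ∈ tabulate b
∈-tabulate⁺ b {x} t =
  lookup⇒[]= x _ (trans (lookup∘tabulate b x) (Equivalence.to T-≡ t))

∈-tabulate⁻ : ∀ (b : Fin n → Bool) {x} → x ∈ tabulate b → T (b x)
∈-tabulate⁻ b {x} x∈ =
  Equivalence.from T-≡ (trans (sym (lookup∘tabulate b x)) ([]=⇒lookup x∈))

∈-image⁺ : ∀ (f : Fin m → Fin n) p {x} → x ∈ p → f x ∈ image f p
∈-image⁺ f p x∈p = ∈-tabulate⁺ _ (fromWitness (_ , x∈p , refl))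

∈-image⁻ : ∀ (f : Fin m → Fin n) p {y} → y ∈ image f p → ∃ λ x → x ∈ p × f x ≡ y
∈-image⁻ f p y∈ = toWitness (∈-tabulate⁻ _ y∈)

image-cong : ∀ {f g : Fin m → Fin n} → f ≗ g → ∀ p → image f p ≡ image g p
image-cong {f = f} {g} f≗g p = ⊆-antisym (incl f≗g) (incl (sym ∘ f≗g))
  where
  incl : ∀ {f g} → f ≗ g → ∀ {y} → y ∈ image f p → y ∈ image g p
  incl {f} {g} f≗g y∈ with ∈-image⁻ f p y∈
  ... | x , x∈p , refl = subst (_∈ image g p) (sym (f≗g x)) (∈-image⁺ g p x∈p)

∣⁅x⁆∪p∣≡1+∣p∣ : ∀ {x : Fin n} p → x ∉ p → ∣ ⁅ x ⁆ ∪ p ∣ ≡ suc ∣ p ∣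
∣⁅x⁆∪p∣≡1+∣p∣ {x = zero}  (inside  ∷ p) x∉p = contradiction Vec.here x∉p
∣⁅x⁆∪p∣≡1+∣p∣ {x = zero}  (outside ∷ p) x∉p = cong (suc ∘ ∣_∣) (∪-identityˡ p)
∣⁅x⁆∪p∣≡1+∣p∣ {x = suc x} (inside  ∷ p) x∉p = cong suc (∣⁅x⁆∪p∣≡1+∣p∣ p (x∉p ∘ Vec.there))
∣⁅x⁆∪p∣≡1+∣p∣ {x = suc x} (outside ∷ p) x∉p = ∣⁅x⁆∪p∣≡1+∣p∣ p (x∉p ∘ Vec.there)

x∉p-x : ∀ (x : Fin n) p → x ∉ p - x
x∉p-x zero    (inside  ∷ p) ()
x∉p-x zero    (outside ∷ p) ()
x∉p-x (suc x) (_ ∷ p) (Vec.there x∈) = x∉p-x x p x∈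

⁅x⁆∪[p-x]≡p : ∀ {x : Fin n} {p} → x ∈ p → ⁅ x ⁆ ∪ (p - x) ≡ p
⁅x⁆∪[p-x]≡p {x = x} {p} x∈p = ⊆-antisym to from
  where
  to : ∀ {y} → y ∈ ⁅ x ⁆ ∪ (p - x) → y ∈ p
  to y∈ with x∈p∪q⁻ ⁅ x ⁆ (p - x) y∈
  ... | inj₁ y∈x   = subst (_∈ p) (sym (x∈⁅y⁆⇒x≡y x y∈x)) x∈p
  ... | inj₂ y∈p-x = p─q⊆p p ⁅ x ⁆ y∈p-x
  from : ∀ {y} → y ∈ p → y ∈ ⁅ x ⁆ ∪ (p - x)
  from {y} y∈p with y ≟ x
  ... | yes refl = x∈p∪q⁺ (inj₁ (x∈⁅x⁆ x))
  ... | no  y≢x  = x∈p∪q⁺ (inj₂ (x∈p∧x≢y⇒x∈p-y y∈p y≢x))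

∣p∣≡1+∣p-x∣ : ∀ {x : Fin n} {p} → x ∈ p → ∣ p ∣ ≡ suc ∣ p - x ∣
∣p∣≡1+∣p-x∣ {x = x} {p} x∈p =
  trans (cong ∣_∣ (sym (⁅x⁆∪[p-x]≡p x∈p))) (∣⁅x⁆∪p∣≡1+∣p∣ (p - x) (x∉p-x x p))

∣p∣≡0⇒p≡⊥ : ∀ {p : Subset n} → ∣ p ∣ ≡ 0 → p ≡ ⊥
∣p∣≡0⇒p≡⊥ ∣p∣≡0 = Empty-unique λ (x , x∈p) →
  contradiction (trans (sym (∣p∣≡1+∣p-x∣ x∈p)) ∣p∣≡0) λ ()

∣p∣≡suc⇒Nonempty : ∀ {p : Subset n} → ∣ p ∣ ≡ suc m → Nonempty p
∣p∣≡suc⇒Nonempty {n} {p = p} eq with nonempty? p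
... | yes ne = ne
... | no ¬ne = contradiction
  (trans (sym eq) (trans (cong ∣_∣ (Empty-unique ¬ne)) (∣⊥∣≡0 n))) λ ()

∣p∣≡1⇒singleton : ∀ {p : Subset n} → ∣ p ∣ ≡ 1 → ∃ λ x → p ≡ ⁅ x ⁆
∣p∣≡1⇒singleton {p = p} ∣p∣≡1 with ∣p∣≡suc⇒Nonempty ∣p∣≡1
... | x , x∈p = x , (begin
  p                 ≡⟨ sym (⁅x⁆∪[p-x]≡p x∈p) ⟩
  ⁅ x ⁆ ∪ (p - x)   ≡⟨ cong (⁅ x ⁆ ∪_) (∣p∣≡0⇒p≡⊥ (ℕ.suc-injective
                         (trans (sym (∣p∣≡1+∣p-x∣ x∈p)) ∣p∣≡1))) ⟩
  ⁅ x ⁆ ∪ ⊥         ≡⟨ ∪-identityʳ ⁅ x ⁆ ⟩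
  ⁅ x ⁆             ∎)
  where open ≡-Reasoning

∣p∣≡2⇒pair : ∀ {p : Subset n} {x} → x ∈ p → ∣ p ∣ ≡ 2 →
             ∃ λ y → x ≢ y × p ≡ ⁅ x ⁆ ∪ ⁅ y ⁆
∣p∣≡2⇒pair {p = p} {x} x∈p ∣p∣≡2
  with ∣p∣≡1⇒singleton (ℕ.suc-injective (trans (sym (∣p∣≡1+∣p-x∣ x∈p)) ∣p∣≡2))
... | y , p-x≡y =
  y , (λ { refl → x∉p-x x p (subst (x ∈_) (sym p-x≡y) (x∈⁅x⁆ x)) })
    , trans (sym (⁅x⁆∪[p-x]≡p x∈p)) (cong (⁅ x ⁆ ∪_) p-x≡y)

∣⁅x⁆∪⁅y⁆∣≡2 : ∀ {x y : Fin n} → x ≢ y → ∣ ⁅ x ⁆ ∪ ⁅ y ⁆ ∣ ≡ 2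
∣⁅x⁆∪⁅y⁆∣≡2 {y = y} x≢y =
  trans (∣⁅x⁆∪p∣≡1+∣p∣ ⁅ y ⁆ (x≢y ∘ x∈⁅y⁆⇒x≡y y)) (cong suc (∣⁅x⁆∣≡1 y))

injection⇒≤∣p∣ : ∀ (f : Fin m → Fin n) p → Injective _≡_ _≡_ f →
                 (∀ i → f i ∈ p) → m ≤ ∣ p ∣
injection⇒≤∣p∣ {zero}  f p inj f∈p = z≤n
injection⇒≤∣p∣ {suc m} f p inj f∈p = ℕ.≤-<-trans
  (injection⇒≤∣p∣ (f ∘ suc) (p - f zero) (Fin.suc-injective ∘ inj)
    λ i → x∈p∧x≢y⇒x∈p-y (f∈p (suc i)) λ eq → 0≢1+n (sym (inj eq)))
  (x∈p⇒∣p-x∣<∣p∣ (f∈p zero))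

-- Inclusion-exclusion together with the fact that the union has at most `n` elements, checked point
-- by point.
∣p∣+∣q∣≤∣p∩q∣+n : ∀ (p q : Subset n) → ∣ p ∣ + ∣ q ∣ ≤ ∣ p ∩ q ∣ + n
∣p∣+∣q∣≤∣p∩q∣+n [] [] = z≤n
∣p∣+∣q∣≤∣p∩q∣+n {suc n} (s ∷ p) (t ∷ q) = go s t
  where
  rec : ∣ p ∣ + ∣ q ∣ ≤ ∣ p ∩ q ∣ + n
  rec = ∣p∣+∣q∣≤∣p∩q∣+n p q
  rec′ : suc (∣ p ∣ + ∣ q ∣) ≤ ∣ p ∩ q ∣ + suc n
  rec′ = subst (suc (∣ p ∣ + ∣ q ∣) ≤_) (sym (ℕ.+-suc ∣ p ∩ q ∣ n)) (s≤s rec)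
  go : ∀ s t → ∣ s ∷ p ∣ + ∣ t ∷ q ∣ ≤ ∣ (s ∷ p) ∩ (t ∷ q) ∣ + suc n
  go inside  inside  rewrite ℕ.+-suc ∣ p ∣ ∣ q ∣ = s≤s rec′
  go inside  outside = rec′
  go outside inside  rewrite ℕ.+-suc ∣ p ∣ ∣ q ∣ = rec′
  go outside outside = ℕ.≤-trans (ℕ.n≤1+n _) rec′

-- Sets of three vertices

triple : (u v w : Fin n) → Subset n
triple u v w = ⁅ u ⁆ ∪ (⁅ v ⁆ ∪ ⁅ w ⁆)

module _ {u v w : Fin n} where

  ∈-triple⁻ : ∀ {y} → y ∈ triple u v w → y ≡ u ⊎ y ≡ v ⊎ y ≡ w
  ∈-triple⁻ y∈ with x∈p∪q⁻ ⁅ u ⁆ (⁅ v ⁆ ∪ ⁅ w ⁆) y∈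
  ... | inj₁ y∈u = inj₁ (x∈⁅y⁆⇒x≡y u y∈u)
  ... | inj₂ y∈vw with x∈p∪q⁻ ⁅ v ⁆ ⁅ w ⁆ y∈vw
  ...   | inj₁ y∈v = inj₂ (inj₁ (x∈⁅y⁆⇒x≡y v y∈v))
  ...   | inj₂ y∈w = inj₂ (inj₂ (x∈⁅y⁆⇒x≡y w y∈w))

  u∈triple : u ∈ triple u v w
  u∈triple = x∈p∪q⁺ (inj₁ (x∈⁅x⁆ u))

  v∈triple : v ∈ triple u v w
  v∈triple = x∈p∪q⁺ {p = ⁅ u ⁆} (inj₂ (x∈p∪q⁺ (inj₁ (x∈⁅x⁆ v))))

  w∈triple : w ∈ triple u v w
  w∈triple = x∈p∪q⁺ {p = ⁅ u ⁆} (inj₂ (x∈p∪q⁺ {p = ⁅ v ⁆} (inj₂ (x∈⁅x⁆ w))))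

  ∣triple∣≡3 : u ≢ v → u ≢ w → v ≢ w → ∣ triple u v w ∣ ≡ 3
  ∣triple∣≡3 u≢v u≢w v≢w = trans (∣⁅x⁆∪p∣≡1+∣p∣ _ u∉vw) (cong suc (∣⁅x⁆∪⁅y⁆∣≡2 v≢w))
    where
    u∉vw : u ∉ ⁅ v ⁆ ∪ ⁅ w ⁆
    u∉vw u∈ = [ u≢v ∘ x∈⁅y⁆⇒x≡y v , u≢w ∘ x∈⁅y⁆⇒x≡y w ] (x∈p∪q⁻ ⁅ v ⁆ ⁅ w ⁆ u∈)

triple-rotate : ∀ (u v w : Fin n) → triple u v w ≡ triple v w u
triple-rotate u v w = trans (∪-comm ⁅ u ⁆ _) (∪-assoc ⁅ v ⁆ ⁅ w ⁆ ⁅ u ⁆)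

triple-swap : ∀ (u v w : Fin n) → triple u v w ≡ triple u w v
triple-swap u v w = cong (⁅ u ⁆ ∪_) (∪-comm ⁅ v ⁆ ⁅ w ⁆)

∣⁅x⁆∪p∣≤1+∣p∣ : ∀ (x : Fin n) p → ∣ ⁅ x ⁆ ∪ p ∣ ≤ suc ∣ p ∣
∣⁅x⁆∪p∣≤1+∣p∣ x p with x ∈? p
... | no  x∉p = ℕ.≤-reflexive (∣⁅x⁆∪p∣≡1+∣p∣ p x∉p)
... | yes x∈p = ℕ.m≤n⇒m≤1+n (p⊆q⇒∣p∣≤∣q∣ λ y∈ →
  [ (λ y∈x → subst (_∈ p) (sym (x∈⁅y⁆⇒x≡y x y∈x)) x∈p) , (λ y∈p → y∈p) ]
  (x∈p∪q⁻ ⁅ x ⁆ p y∈))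

-- Equal entries would leave at most two elements. This is how distinctness of vertices is read off
-- from an edge.
∣triple∣≡3⇒v≢w : ∀ (u v w : Fin n) → ∣ triple u v w ∣ ≡ 3 → v ≢ w
∣triple∣≡3⇒v≢w u v _ eq refl = ℕ.<-irrefl refl (begin-strict
  2                       <⟨ ℕ.≤-reflexive (sym eq) ⟩
  ∣ triple u v v ∣        ≤⟨ ∣⁅x⁆∪p∣≤1+∣p∣ u _ ⟩
  suc ∣ ⁅ v ⁆ ∪ ⁅ v ⁆ ∣   ≡⟨ cong (suc ∘ ∣_∣) (∪-idem ⁅ v ⁆) ⟩
  suc ∣ ⁅ v ⁆ ∣           ≡⟨ cong suc (∣⁅x⁆∣≡1 v) ⟩
  2                       ∎)
  where open ℕ.≤-Reasoning

∣triple∣≡3⇒u≢w : ∀ (u v w : Fin n) → ∣ triple u v w ∣ ≡ 3 → u ≢ w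
∣triple∣≡3⇒u≢w u v w eq =
  ∣triple∣≡3⇒v≢w v w u (trans (cong ∣_∣ (sym (triple-rotate u v w))) eq) ∘ sym

-- Removing `u` leaves a pair containing `v`; its other element is `w`. It serves to trade edges
-- through a pair for their third vertices.
∣p∣≡3⇒triple : ∀ {p : Subset n} {u v} → ∣ p ∣ ≡ 3 → u ∈ p → v ∈ p → u ≢ v →
               ∃ λ w → p ≡ triple u v w
∣p∣≡3⇒triple ∣p∣≡3 u∈p v∈p u≢v
  with ∣p∣≡2⇒pair (x∈p∧x≢y⇒x∈p-y v∈p (u≢v ∘ sym))
                  (ℕ.suc-injective (trans (sym (∣p∣≡1+∣p-x∣ u∈p)) ∣p∣≡3))
... | w , _ , eq = w , trans (sym (⁅x⁆∪[p-x]≡p u∈p)) (cong (⁅ _ ⁆ ∪_) eq)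

image-triple : ∀ (f : Fin m → Fin n) a b c →
               image f (triple a b c) ≡ triple (f a) (f b) (f c)
image-triple f a b c = ⊆-antisym to from
  where
  to : ∀ {y} → y ∈ image f (triple a b c) → y ∈ triple (f a) (f b) (f c)
  to y∈ with ∈-image⁻ f (triple a b c) y∈
  ... | x , x∈ , refl with ∈-triple⁻ x∈
  ...   | inj₁ refl        = u∈triple
  ...   | inj₂ (inj₁ refl) = v∈triple
  ...   | inj₂ (inj₂ refl) = w∈triple
  from : ∀ {y} → y ∈ triple (f a) (f b) (f c) → y ∈ image f (triple a b c)
  from y∈ with ∈-triple⁻ y∈
  ... | inj₁ refl        = ∈-image⁺ f _ u∈triple
  ... | inj₂ (inj₁ refl) = ∈-image⁺ f _ v∈triple
  ... | inj₂ (inj₂ refl) = ∈-image⁺ f _ w∈triple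

-- Codegrees and links

-- This is the neighbourhood of `v` in the link graph of `u`.
link : 3-Graph n → Fin n → Fin n → Subset n
link H u v = tabulate λ w → 3-Graph.isEdge H (triple u v w)

module _ (H : 3-Graph n) where
  open 3-Graph H using (isEdge; uniform)

  ∈-link⁺ : ∀ {u v w} → Edge H (triple u v w) → w ∈ link H u v
  ∈-link⁺ {u} {v} = ∈-tabulate⁺ (isEdge ∘ triple u v)

  ∈-link⁻ : ∀ {u v w} → w ∈ link H u v → Edge H (triple u v w)
  ∈-link⁻ {u} {v} = ∈-tabulate⁻ (isEdge ∘ triple u v)

  -- An edge through `u` and `v` is determined by its third vertex, so distinct edges give distinct
  -- elements of the link.
  codegree≤∣link∣ : ∀ {u v} → u ≢ v → CodegreeAtLeast H u v d → d ≤ ∣ link H u v ∣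
  codegree≤∣link∣ {u = u} {v} u≢v (es , inj , through) =
    injection⇒≤∣p∣ (proj₁ ∘ third) (link H u v)
      (λ {i} {j} eq → inj (trans (proj₂ (third i))
        (trans (cong (triple u v) eq) (sym (proj₂ (third j))))))
      (λ i → ∈-link⁺ (subst (Edge H) (proj₂ (third i)) (proj₁ (through i))))
    where
    third : ∀ i → ∃ λ w → es i ≡ triple u v w
    third i with through i
    ... | e , u∈e , v∈e = ∣p∣≡3⇒triple (uniform (es i) e) u∈e v∈e u≢v

  Edge⇒pair : ∀ {e} → Edge H e → ∃ λ u → ∃ λ v → u ≢ v × u ∈ e × v ∈ e
  Edge⇒pair {e} he with ∣p∣≡suc⇒Nonempty (uniform e he)
  ... | u , u∈e with ∣p∣≡suc⇒Nonempty
                       (ℕ.suc-injective (trans (sym (∣p∣≡1+∣p-x∣ u∈e)) (uniform e he)))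
  ...   | v , v∈e-u =
    u , v , (λ { refl → x∉p-x u e v∈e-u }) , u∈e , p─q⊆p e ⁅ u ⁆ v∈e-u

  -- An edge supplies a pair to which the codegree condition applies, and the link of that pair has
  -- at most `n` elements.
  positiveCodegrees≤n : ∃ (Edge H) → PositiveCodegreesAtLeast H d → d ≤ n
  positiveCodegrees≤n (e , he) cod with Edge⇒pair he
  ... | u , v , u≢v , u∈e , v∈e = ℕ.≤-trans
    (codegree≤∣link∣ u≢v (cod u v u≢v (e , he , u∈e , v∈e))) (∣p∣≤n (link H u v))

  edgeThrough? : ∀ u v → Decidable (EdgeThrough H u v)
  edgeThrough? u v e = T? (isEdge e) ×-dec (u ∈? e) ×-dec (v ∈? e)

  codegreeAtLeast? : ∀ u v → Decidable (CodegreeAtLeast H u v)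
  codegreeAtLeast? u v m = any-function? anySubset? m
    (λ f≗g (inj , through) → injective-resp-≗ f≗g inj ,
                             λ i → subst (EdgeThrough H u v) (f≗g i) (through i))
    (λ es → injective? (≡-dec Bool._≟_) es ×-dec all? (edgeThrough? u v ∘ es))

  positiveCodegreesAtLeast? : Decidable (PositiveCodegreesAtLeast H)
  positiveCodegreesAtLeast? m = all? λ u → all? λ v →
    ¬? (u ≟ v) →-dec anySubset? (edgeThrough? u v) →-dec codegreeAtLeast? u v m

  δ₂⁺-maximum : ∃ (Edge H) → ∃ (IsMaximum (PositiveCodegreesAtLeast H))
  δ₂⁺-maximum ne = maximum positiveCodegreesAtLeast?
    -- The value 0 is always admissible, witnessed by the empty family of edges.
    (λ _ _ _ _ → (λ ()) , (λ {}) , λ ()) n (λ _ → positiveCodegrees≤n ne)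

  δ₂⁺-exists : ∃ (Isδ₂⁺ H)
  δ₂⁺-exists with anySubset? (T? ∘ isEdge)
  ... | yes ne = _ , nonempty ne (proj₂ (δ₂⁺-maximum ne))
  ... | no ¬ne = 0 , edgeless λ e he → ¬ne (e , he)

  δ₂⁺-unique : ∀ {c d} → Isδ₂⁺ H c → Isδ₂⁺ H d → c ≡ d
  δ₂⁺-unique (edgeless _)    (edgeless _)    = refl
  δ₂⁺-unique (edgeless none) (nonempty (e , he) _) = contradiction he (none e)
  δ₂⁺-unique (nonempty (e , he) _) (edgeless none) = contradiction he (none e)
  δ₂⁺-unique (nonempty _ c) (nonempty _ d) = maximum-unique c d

  -- The value exists and is unique, so it suffices to compare `d` with the computed one; the
  -- unbounded quantifier in `IsMaximum` is never searched.
  isδ₂⁺? : Decidable (Isδ₂⁺ H)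
  isδ₂⁺? d = map′ (λ { refl → proj₂ δ₂⁺-exists }) (δ₂⁺-unique (proj₂ δ₂⁺-exists))
                  (proj₁ δ₂⁺-exists ℕ.≟ d)

  contains? : ∀ (F : 3-Graph m) → Dec (Contains H F)
  contains? F = any-function? any? _
    (λ f≗g (inj , edges) → injective-resp-≗ f≗g inj ,
                           λ e he → subst (Edge H) (image-cong f≗g e) (edges e he))
    (λ f → injective? _≟_ f ×-dec
           allSubset? λ e → T? (3-Graph.isEdge F e) →-dec T? (isEdge (image f e)))

-- Existence of the extremal number

infix 4 _≈_
-- Having the same edges replaces propositional equality, which would call for function
-- extensionality. The properties searched over all 3-graphs must respect it.
record _≈_ (G H : 3-Graph n) : Set where
  constructor mk≈
  field
    isEdge-≗ : 3-Graph.isEdge G ≗ 3-Graph.isEdge H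
open _≈_

≈-sym : ∀ {G H : 3-Graph n} → G ≈ H → H ≈ G
≈-sym G≈H = mk≈ (sym ∘ isEdge-≗ G≈H)

Edge-resp-≈ : ∀ {G H : 3-Graph n} → G ≈ H → ∀ {e} → Edge G e → Edge H e
Edge-resp-≈ G≈H {e} = subst T (isEdge-≗ G≈H e)

Free-resp-≈ : ∀ {F : 3-Graph m} {G H : 3-Graph n} → G ≈ H → Free F G → Free F H
Free-resp-≈ G≈H free (f , inj , edges) =
  free (f , inj , λ e → Edge-resp-≈ (≈-sym G≈H) ∘ edges e)

positiveCodegrees-resp-≈ : ∀ {G H : 3-Graph n} → G ≈ H →
  PositiveCodegreesAtLeast G d → PositiveCodegreesAtLeast H d
positiveCodegrees-resp-≈ G≈H cod u v u≢v (e , he , mem)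
  with cod u v u≢v (e , Edge-resp-≈ (≈-sym G≈H) he , mem)
... | es , inj , through =
  es , inj , λ i → Edge-resp-≈ G≈H (proj₁ (through i)) , proj₂ (through i)

Isδ₂⁺-resp-≈ : ∀ {G H : 3-Graph n} → G ≈ H → Isδ₂⁺ G d → Isδ₂⁺ H d
Isδ₂⁺-resp-≈ G≈H (edgeless none) = edgeless λ e → none e ∘ Edge-resp-≈ (≈-sym G≈H)
Isδ₂⁺-resp-≈ G≈H (nonempty (e , he) (cod , max)) = nonempty (e , Edge-resp-≈ G≈H he)
  (positiveCodegrees-resp-≈ G≈H cod ,
   λ m → max m ∘ positiveCodegrees-resp-≈ (≈-sym G≈H))

-- Imposing size 3 turns any Boolean test into a 3-graph, and up to `_≈_` every 3-graph arises so.
-- Searching 3-graphs thereby becomes searching Boolean tests.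
restrict : (Subset n → Bool) → 3-Graph n
restrict b = record
  { isEdge  = λ e → b e ∧ (∣ e ∣ ≡ᵇ 3)
  ; uniform = λ e he → ℕ.≡ᵇ⇒≡ ∣ e ∣ 3 (proj₂ (Equivalence.to (T-∧ {b e}) he))
  }

≈-restrict : ∀ (H : 3-Graph n) → H ≈ restrict (3-Graph.isEdge H)
≈-restrict H = mk≈ λ e → agree (3-Graph.isEdge H e) (3-Graph.uniform H e)
  where
  agree : ∀ b {m} → (T b → m ≡ 3) → b ≡ b ∧ (m ≡ᵇ 3)
  agree false _   = refl
  agree true  m≡3 = sym (Equivalence.to T-≡ (ℕ.≡⇒≡ᵇ _ 3 (m≡3 _)))

any-3-graph? : ∀ {P : 3-Graph n → Set} → (∀ {G H} → G ≈ H → P G → P H) →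
               Decidable P → Dec (∃ P)
any-3-graph? resp P? =
  map′ (λ (b , p) → restrict b , p)
       (λ (H , p) → 3-Graph.isEdge H , resp (≈-restrict H) p)
       (any-predicate? _ (λ b≗c → resp (mk≈ λ e → cong (_∧ (∣ e ∣ ≡ᵇ 3)) (b≗c e))) (P? ∘ restrict))

∅ : 3-Graph n
∅ = restrict λ _ → false

co⁺ex-exists : ∀ (F : 3-Graph m) N → ∃ (Edge F) →
               (∀ (H : 3-Graph n) {d} → Free F H → Isδ₂⁺ H d → d ≤ N) →
               ∃ (IsCo⁺ex n F)
co⁺ex-exists F N (e , he) bound = maximum
  (λ d → any-3-graph?
    (λ G≈H (free , δ) → Free-resp-≈ {F = F} G≈H free , Isδ₂⁺-resp-≈ G≈H δ)
    (λ H → ¬? (contains? H F) ×-dec isδ₂⁺? H d))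
  -- The edgeless 3-graph attains 0; it is `F`-free because a copy of `F` would need an image of the
  -- edge `e`.
  (∅ , (λ (f , _ , edges) → edges e he) , edgeless λ _ ())
  N (λ d (H , free , δ) → bound H free δ)

-- Copies of J

J-edge : ∀ {i j : Fin k} → i ≢ j → Edge (J k) (triple zero (suc i) (suc j))
J-edge {i = i} {j} i≢j =
  ℕ.≡⇒≡ᵇ _ 2 (trans (cong ∣_∣ (∪-identityˡ (⁅ i ⁆ ∪ ⁅ j ⁆))) (∣⁅x⁆∪⁅y⁆∣≡2 i≢j))

J-edge⁻ : ∀ e → Edge (J k) e →
          ∃ λ i → ∃ λ j → i ≢ j × e ≡ triple zero (suc i) (suc j)
J-edge⁻ (inside ∷ p) he with ℕ.≡ᵇ⇒≡ ∣ p ∣ 2 he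
... | ∣p∣≡2 with ∣p∣≡suc⇒Nonempty ∣p∣≡2
...   | i , i∈p with ∣p∣≡2⇒pair i∈p ∣p∣≡2
...     | j , i≢j , eq = i , j , i≢j , cong (inside ∷_) (trans eq (sym (∪-identityˡ _)))

-- The vertex `x` plays the centre of `J k` and the clique in its link plays the other vertices.
-- These are distinct since two of them form an edge with `x`, and edges have three elements.
clique⇒contains-J : ∀ (H : 3-Graph n) x (v : Fin k → Fin n) →
  (∀ i → x ≢ v i) → (∀ i j → i ≢ j → Edge H (triple x (v i) (v j))) → Contains H (J k)
clique⇒contains-J {n} {k} H x v x≢v clique = f , inj , edges
  where
  f : Fin (suc k) → Fin n
  f = x Vector.∷ v
  inj : Injective _≡_ _≡_ f
  inj {zero}  {zero}  eq = refl
  inj {zero}  {suc j} eq = contradiction eq (x≢v j)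
  inj {suc i} {zero}  eq = contradiction (sym eq) (x≢v i)
  inj {suc i} {suc j} eq with i ≟ j
  ... | yes refl = refl
  ... | no  i≢j  = contradiction eq
    (∣triple∣≡3⇒v≢w x (v i) (v j) (3-Graph.uniform H _ (clique i j i≢j)))
  edges : ∀ e → Edge (J k) e → Edge H (image f e)
  edges e he with J-edge⁻ e he
  ... | i , j , i≢j , refl =
    subst (Edge H) (sym (image-triple f zero (suc i) (suc j))) (clique i j i≢j)

-- The upper bound

module UpperBound (H : 3-Graph n) (cod : PositiveCodegreesAtLeast H d) (x : Fin n) where

  -- The state of the greedy process: a clique with `suc j` vertices in the link of `x`, together
  -- with a set `common` of common neighbours. The field `large` is the estimate (j + 1) d - j n ≤
  -- |common|, written without truncated subtraction.
  record LinkClique (j : ℕ) : Set where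
    field
      vertex : Fin (suc j) → Fin n
      x≢v    : ∀ i → x ≢ vertex i
      clique : ∀ i i′ → i ≢ i′ → Edge H (triple x (vertex i) (vertex i′))
      common : Subset n
      edge   : ∀ {w} → w ∈ common → ∀ i → Edge H (triple x (vertex i) w)
      large  : suc j * d ≤ ∣ common ∣ + j * n

  d≤∣link∣ : ∀ {v e} → x ≢ v → EdgeThrough H x v e → d ≤ ∣ link H x v ∣
  d≤∣link∣ {v} x≢v through = codegree≤∣link∣ H x≢v (cod x v x≢v (_ , through))

  singleton : ∀ {v e} → x ≢ v → EdgeThrough H x v e → LinkClique 0
  singleton {v} x≢v through = record
    { vertex = λ _ → v
    ; x≢v    = λ _ → x≢v
    ; clique = λ { zero zero i≢i → contradiction refl i≢i }
    ; common = link H x v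
    ; edge   = λ w∈ _ → ∈-link⁻ H w∈
    ; large  = ℕ.+-monoˡ-≤ 0 (d≤∣link∣ x≢v through)
    }

  -- Any common neighbour `v` joins the clique, and `common` is cut down to the neighbours of `v`.
  -- By inclusion-exclusion the lower estimate changes by d - n, which is what `large` demands for
  -- `suc j`.
  extend : ∀ {j} → (L : LinkClique j) → Nonempty (LinkClique.common L) → LinkClique (suc j)
  extend {j} L (v , v∈common) = record
    { vertex = v Vector.∷ vertex
    ; x≢v    = λ { zero → x≢new ; (suc i) → x≢v i }
    ; clique = λ
        { zero    zero    i≢i  → contradiction refl i≢i
        ; zero    (suc i) _    → subst (Edge H) (triple-swap x (vertex i) v) (edge v∈common i)
        ; (suc i) zero    _    → edge v∈common i
        ; (suc i) (suc j) i≢j → clique i j (i≢j ∘ cong suc)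
        }
    ; common = common ∩ link H x v
    ; edge   = λ
        { w∈ zero    → ∈-link⁻ H (proj₂ (x∈p∩q⁻ common (link H x v) w∈))
        ; w∈ (suc i) → edge (proj₁ (x∈p∩q⁻ common (link H x v) w∈)) i
        }
    ; large  = begin
        d + suc j * d                                   ≤⟨ ℕ.+-mono-≤ d≤∣N∣ large ⟩
        ∣ N ∣ + (∣ common ∣ + j * n)                    ≡⟨ sym (ℕ.+-assoc ∣ N ∣ ∣ common ∣ (j * n)) ⟩
        ∣ N ∣ + ∣ common ∣ + j * n                      ≡⟨ cong (_+ j * n) (ℕ.+-comm ∣ N ∣ ∣ common ∣) ⟩
        ∣ common ∣ + ∣ N ∣ + j * n                      ≤⟨ ℕ.+-monoˡ-≤ (j * n) (∣p∣+∣q∣≤∣p∩q∣+n common N) ⟩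
        ∣ common ∩ N ∣ + n + j * n                      ≡⟨ ℕ.+-assoc ∣ common ∩ N ∣ n (j * n) ⟩
        ∣ common ∩ N ∣ + (n + j * n)                    ∎
    }
    where
    open LinkClique L
    open ℕ.≤-Reasoning
    N = link H x v
    x≢new : x ≢ v
    x≢new = ∣triple∣≡3⇒u≢w x (vertex zero) v (3-Graph.uniform H _ (edge v∈common zero))
    d≤∣N∣ : d ≤ ∣ N ∣
    -- The edge joining `v` to an earlier clique vertex shows that the pair `x`, `v` has positive
    -- codegree.
    d≤∣N∣ = d≤∣link∣ x≢new (edge v∈common zero , u∈triple , w∈triple)

  -- If `common` is empty, `large` itself becomes the second alternative.
  extend? : ∀ {j} → LinkClique j → LinkClique (suc j) ⊎ suc j * d ≤ j * n
  extend? {j} L with nonempty? (LinkClique.common L)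
  ... | yes ne = inj₁ (extend L ne)
  ... | no ¬ne = inj₂ (subst (λ c → suc j * d ≤ c + j * n)
                             (trans (cong ∣_∣ (Empty-unique ¬ne)) (∣⊥∣≡0 n))
                             (LinkClique.large L))

  linkClique : LinkClique 0 → d ≤ n → ∀ j → LinkClique (suc j) ⊎ suc j * d ≤ j * n
  linkClique L d≤n zero    = extend? L
  -- If growth has already stopped, adding `d ≤ n` to the inequality for `j` gives the one for
  -- `suc j`.
  linkClique L d≤n (suc j) = [ extend? , (inj₂ ∘ ℕ.+-mono-≤ d≤n) ] (linkClique L d≤n j)

-- A `LinkClique (suc k)` has `2 + k` vertices, exactly enough for `J (2 + k)`. In a `J`-free
-- 3-graph the growth must therefore stop earlier, leaving the inequality.
J-free⇒bound : ∀ k (H : 3-Graph n) → Free (J (2 + k)) H → Isδ₂⁺ H d → suc k * d ≤ k * n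
J-free⇒bound {n} k H free (edgeless _) = subst (_≤ k * n) (sym (ℕ.*-zeroʳ k)) z≤n
J-free⇒bound {n} {d} k H free (nonempty ne@(e , he) (cod , _)) with Edge⇒pair H he
... | x , v , x≢v , x∈e , v∈e = [ contains-J , (λ bound → bound) ]
  (linkClique (singleton x≢v (he , x∈e , v∈e)) (positiveCodegrees≤n H ne cod) k)
  where
  open UpperBound H cod x
  contains-J : LinkClique (suc k) → suc k * d ≤ k * n
  contains-J L = contradiction
    (clique⇒contains-J H x (vertex L) (LinkClique.x≢v L) (clique L)) free
    where open LinkClique using (vertex; clique)

-- The lower bound

module Multipartite (χ : Fin n → Fin k) where

  -- Injectivity of `χ` on `e`. With size 3 imposed, this defines the complete multipartite 3-graph
  -- whose classes are the fibres of `χ`.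
  Rainbow : Subset n → Set
  Rainbow e = ∀ u v → u ∈ e → v ∈ e → χ u ≡ χ v → u ≡ v

  rainbow? : Decidable Rainbow
  rainbow? e = all? λ u → all? λ v →
    (u ∈? e) →-dec (v ∈? e) →-dec (χ u ≟ χ v) →-dec (u ≟ v)

  multipartite : 3-Graph n
  multipartite = restrict λ e → ⌊ rainbow? e ⌋

  edge⁺ : ∀ {e} → Rainbow e → ∣ e ∣ ≡ 3 → Edge multipartite e
  edge⁺ {e} rb ∣e∣≡3 =
    Equivalence.from T-∧ (fromWitness {a? = rainbow? e} rb , ℕ.≡⇒≡ᵇ ∣ e ∣ 3 ∣e∣≡3)

  edge⁻ : ∀ {e} → Edge multipartite e → Rainbow e
  edge⁻ {e} he = toWitness {a? = rainbow? e} (proj₁ (Equivalence.to T-∧ he))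

  triple-edge : ∀ {u v w} → χ u ≢ χ v → χ u ≢ χ w → χ v ≢ χ w →
                Edge multipartite (triple u v w)
  triple-edge {u} {v} {w} uv uw vw = edge⁺
    (λ y z y∈ z∈ → rainbow (∈-triple⁻ y∈) (∈-triple⁻ z∈))
    (∣triple∣≡3 (uv ∘ cong χ) (uw ∘ cong χ) (vw ∘ cong χ))
    where
    rainbow : ∀ {y z} → y ≡ u ⊎ y ≡ v ⊎ y ≡ w → z ≡ u ⊎ z ≡ v ⊎ z ≡ w → χ y ≡ χ z → y ≡ z
    rainbow (inj₁ refl)        (inj₁ refl)        eq = refl
    rainbow (inj₁ refl)        (inj₂ (inj₁ refl)) eq = contradiction eq uv
    rainbow (inj₁ refl)        (inj₂ (inj₂ refl)) eq = contradiction eq uw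
    rainbow (inj₂ (inj₁ refl)) (inj₁ refl)        eq = contradiction (sym eq) uv
    rainbow (inj₂ (inj₁ refl)) (inj₂ (inj₁ refl)) eq = refl
    rainbow (inj₂ (inj₁ refl)) (inj₂ (inj₂ refl)) eq = contradiction eq vw
    rainbow (inj₂ (inj₂ refl)) (inj₁ refl)        eq = contradiction (sym eq) uw
    rainbow (inj₂ (inj₂ refl)) (inj₂ (inj₁ refl)) eq = contradiction (sym eq) vw
    rainbow (inj₂ (inj₂ refl)) (inj₂ (inj₂ refl)) eq = refl

-- Two non-central vertices form an edge with the centre; the centre and one other vertex are
-- completed by a second one. Hence a colouring that is injective on edges of a copy of `J` is
-- injective on the whole copy.
J-pair-in-edge : ∀ (a b : Fin (3 + k)) → a ≢ b →
                 ∃ λ e → Edge (J (2 + k)) e × a ∈ e × b ∈ e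
J-pair-in-edge {k} = λ
  { zero    zero    a≢b → contradiction refl a≢b
  ; zero    (suc j) _   → let (e , he , x∈e , j∈e , _) = spoke-any j in e , he , x∈e , j∈e
  ; (suc i) zero    _   → let (e , he , x∈e , i∈e , _) = spoke-any i in e , he , i∈e , x∈e
  ; (suc i) (suc j) a≢b → let (e , he , _ , ij∈e) = spoke i j (a≢b ∘ cong suc)
                          in e , he , ij∈e
  }
  where
  spoke : ∀ i j → i ≢ j → ∃ λ e → Edge (J (2 + k)) e × zero ∈ e × suc i ∈ e × suc j ∈ e
  spoke i j i≢j = triple zero (suc i) (suc j) , J-edge i≢j ,
    u∈triple {v = suc i} {suc j} , v∈triple {u = zero} {suc i} {suc j} , w∈triple {u = zero} {suc i}
  spoke-any : ∀ i → ∃ λ e → Edge (J (2 + k)) e × zero ∈ e × suc i ∈ e × suc (punchIn i zero) ∈ e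
  -- With at least two non-central vertices, `punchIn i zero` is one different from `i`.
  spoke-any i = spoke i (punchIn i zero) (punchInᵢ≢i i zero ∘ sym)

-- The `3 + k` vertices of a copy would receive pairwise different colours out of only `2 + k`.
multipartite-J-free : ∀ (χ : Fin n → Fin (2 + k)) →
                      Free (J (2 + k)) (Multipartite.multipartite χ)
multipartite-J-free χ (f , inj , edges) = ℕ.1+n≰n (injective⇒≤ χf-injective)
  where
  χf-injective : Injective _≡_ _≡_ (χ ∘ f)
  χf-injective {a} {b} eq with a ≟ b
  ... | yes a≡b = a≡b
  ... | no  a≢b with J-pair-in-edge a b a≢b
  ...   | e , he , a∈e , b∈e = inj (Multipartite.edge⁻ χ (edges e he) (f a) (f b)
                                      (∈-image⁺ f e a∈e) (∈-image⁺ f e b∈e) eq)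

-- Enumerates the `k` colours besides `a` and `b`: the inner `punchIn` skips the position of `b`
-- once `a` is removed, the outer one skips `a`.
otherColour : (a b : Fin (2 + k)) → a ≢ b → Fin k → Fin (2 + k)
otherColour a b a≢b i = punchIn a (punchIn (punchOut a≢b) i)

otherColour≢a : ∀ (a b : Fin (2 + k)) a≢b i → a ≢ otherColour a b a≢b i
otherColour≢a a b a≢b i = punchInᵢ≢i a _ ∘ sym

otherColour≢b : ∀ (a b : Fin (2 + k)) a≢b i → b ≢ otherColour a b a≢b i
otherColour≢b a b a≢b i eq = punchInᵢ≢i (punchOut a≢b) i
  (sym (punchIn-injective a _ _ (trans (punchIn-punchOut a≢b) eq)))

otherColour-injective : ∀ (a b : Fin (2 + k)) a≢b →
                        Injective _≡_ _≡_ (otherColour a b a≢b)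
otherColour-injective a b a≢b eq =
  punchIn-injective (punchOut a≢b) _ _ (punchIn-injective a _ _ eq)

triple-cancel : ∀ {u v w w′ : Fin n} → u ≢ w → v ≢ w → triple u v w ≡ triple u v w′ → w ≡ w′
triple-cancel {w = w} u≢w v≢w eq with ∈-triple⁻ (subst (w ∈_) eq w∈triple)
... | inj₁ w≡u         = contradiction (sym w≡u) u≢w
... | inj₂ (inj₁ w≡v)  = contradiction (sym w≡v) v≢w
... | inj₂ (inj₂ w≡w′) = w≡w′

module _ {q} (χ : Fin n → Fin (2 + k)) (vertex : Fin q → Fin (2 + k) → Fin n)
         (χ-vertex : ∀ j i → χ (vertex j i) ≡ i)
         (vertex-injective : ∀ {j j′ i} → vertex j i ≡ vertex j′ i → j ≡ j′) where

  open Multipartite χ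

  -- The endpoints have different colours, so each of the `k` other colours offers `q` third
  -- vertices. `remQuot` splits an index below `k * q` into a colour and a position in its class.
  multipartite-codegrees : PositiveCodegreesAtLeast multipartite (k * q)
  multipartite-codegrees u v u≢v (e , he , u∈e , v∈e) =
    es , es-injective , λ i → triple-edge χu≢χv (χu≢ i) (χv≢ i) , u∈triple , v∈triple
    where
    χu≢χv : χ u ≢ χ v
    χu≢χv = u≢v ∘ edge⁻ he u v u∈e v∈e
    colour = otherColour (χ u) (χ v) χu≢χv
    w : Fin (k * q) → Fin n
    w i = let (c , j) = remQuot {k} q i in vertex j (colour c)
    χw : ∀ i → χ (w i) ≡ colour (proj₁ (remQuot {k} q i))
    χw i = χ-vertex _ _
    χu≢ : ∀ i → χ u ≢ χ (w i)
    χu≢ i eq = otherColour≢a (χ u) (χ v) χu≢χv _ (trans eq (χw i))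
    χv≢ : ∀ i → χ v ≢ χ (w i)
    χv≢ i eq = otherColour≢b (χ u) (χ v) χu≢χv _ (trans eq (χw i))
    es : Fin (k * q) → Subset n
    es i = triple u v (w i)
    w-injective : Injective _≡_ _≡_ w
    w-injective {i} {i′} eq = begin
      i                                   ≡⟨ sym (combine-remQuot {k} q i) ⟩
      combine (c i) (j i)                 ≡⟨ cong₂ combine c≡c′ j≡j′ ⟩
      combine (c i′) (j i′)               ≡⟨ combine-remQuot {k} q i′ ⟩
      i′                                  ∎
      where
      open ≡-Reasoning
      c = λ i → proj₁ (remQuot {k} q i)
      j = λ i → proj₂ (remQuot {k} q i)
      c≡c′ : c i ≡ c i′
      c≡c′ = otherColour-injective (χ u) (χ v) χu≢χv
        (trans (sym (χw i)) (trans (cong χ eq) (χw i′)))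
      j≡j′ : j i ≡ j i′
      -- Once the colours agree, both vertices lie in the same enumerated class, where positions are
      -- determined.
      j≡j′ = vertex-injective (trans eq (cong (vertex (j i′) ∘ colour) (sym c≡c′)))
    es-injective : Injective _≡_ _≡_ es
    es-injective {i} eq = w-injective (triple-cancel (χu≢ i ∘ cong χ) (χv≢ i ∘ cong χ) eq)

-- Residue classes as colour classes

-- The vertex numbered k j + i, the `j`-th of residue `i`. It is below `n` because k times the floor
-- of n/k is at most n.
mod-vertex : ∀ n k .{{_ : NonZero k}} → Fin (n / k) → Fin k → Fin n
mod-vertex n k j i = inject≤ (combine j i) (m/n*n≤m n k)

toℕ-mod-vertex : ∀ n k .{{_ : NonZero k}} j i → toℕ (mod-vertex n k j i) ≡ k * toℕ j + toℕ i
toℕ-mod-vertex n k j i = trans (toℕ-inject≤ (combine j i) _) (toℕ-combine j i)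

mod-vertex-colour : ∀ n k .{{_ : NonZero k}} j i → toℕ (mod-vertex n k j i) mod k ≡ i
mod-vertex-colour n k j i = toℕ-injective (begin
  toℕ (toℕ (mod-vertex n k j i) mod k)   ≡⟨ toℕ-fromℕ< _ ⟩
  toℕ (mod-vertex n k j i) % k           ≡⟨ cong (_% k) (toℕ-mod-vertex n k j i) ⟩
  (k * toℕ j + toℕ i) % k                ≡⟨ cong (_% k) (ℕ.+-comm (k * toℕ j) (toℕ i)) ⟩
  (toℕ i + k * toℕ j) % k                ≡⟨ cong (λ m → (toℕ i + m) % k) (ℕ.*-comm k (toℕ j)) ⟩
  (toℕ i + toℕ j * k) % k                ≡⟨ [m+kn]%n≡m%n (toℕ i) (toℕ j) k ⟩
  toℕ i % k                              ≡⟨ m<n⇒m%n≡m (toℕ<n i) ⟩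
  toℕ i                                  ∎)
  where open ≡-Reasoning

lower-bound : ∀ n k {c} → IsCo⁺ex n (J (2 + k)) c → k * (n / (2 + k)) ≤ c
lower-bound n zero    _ = z≤n
lower-bound n (suc k) {c} (_ , max) with n / (3 + k) in eq
-- With fewer vertices than classes the claimed bound is 0. Otherwise every class is inhabited,
-- which provides the edge needed by `nonempty`.
... | zero  = subst (_≤ c) (sym (ℕ.*-zeroʳ k)) z≤n
... | suc q = subst (λ q → suc k * q ≤ c) eq
  (ℕ.≤-trans (proj₂ (proj₂ δ) _ codegrees)
             (max _ (multipartite , multipartite-J-free χ , nonempty edge (proj₂ δ))))
  where
  χ : Fin n → Fin (3 + k)
  χ v = toℕ v mod (3 + k)
  open Multipartite χ
  vertex = mod-vertex n (3 + k)
  χ-vertex = mod-vertex-colour n (3 + k)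
  codegrees : PositiveCodegreesAtLeast multipartite (suc k * (n / (3 + k)))
  codegrees = multipartite-codegrees χ vertex χ-vertex
    λ {j} {j′} {i} eq → combine-injectiveˡ j i j′ i (inject≤-injective _ _ _ _ eq)
  j₀ : Fin (n / (3 + k))
  j₀ = subst Fin (sym eq) zero
  distinct : ∀ {i i′} → i ≢ i′ → χ (vertex j₀ i) ≢ χ (vertex j₀ i′)
  distinct i≢i′ eq = i≢i′ (trans (sym (χ-vertex j₀ _)) (trans eq (χ-vertex j₀ _)))
  edge : ∃ (Edge multipartite)
  edge = triple (vertex j₀ zero) (vertex j₀ (suc zero)) (vertex j₀ (suc (suc zero))) ,
    triple-edge (distinct λ ()) (distinct λ ()) (distinct λ ())
  δ = δ₂⁺-maximum multipartite edge

-- Rational form of the upper bound and conclusion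

-- For unnormalised fractions the order is cross-multiplication of integers, so the claim is moved
-- there, where `integral` is the hypothesis up to factors 1 from the denominators.
cross-multiply : ∀ a b c n → suc b * c ≤ a * n →
                 (+ c ℚ./ 1) ℚ.≤ (+ a ℚ./ suc b) ℚ.* (+ n ℚ./ 1)
cross-multiply a b c n bc≤an = ℚ.toℚᵘ-cancel-≤ (begin
  ℚ.toℚᵘ (+ c ℚ./ 1)                                   ≃⟨ ℚ.toℚᵘ-fromℚᵘ (ℚᵘ.mkℚᵘ (+ c) 0) ⟩
  ℚᵘ.mkℚᵘ (+ c) 0                                      ≤⟨ ℚᵘ.*≤* integral ⟩
  ℚᵘ.mkℚᵘ (+ a) b ℚᵘ.* ℚᵘ.mkℚᵘ (+ n) 0                 ≃⟨ ℚᵘ.*-cong (ℚᵘ.≃-sym (ℚ.toℚᵘ-fromℚᵘ (ℚᵘ.mkℚᵘ (+ a) b)))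
                                                                    (ℚᵘ.≃-sym (ℚ.toℚᵘ-fromℚᵘ (ℚᵘ.mkℚᵘ (+ n) 0))) ⟩
  ℚ.toℚᵘ (+ a ℚ./ suc b) ℚᵘ.* ℚ.toℚᵘ (+ n ℚ./ 1)       ≃⟨ ℚᵘ.≃-sym (ℚ.toℚᵘ-homo-* (+ a ℚ./ suc b) (+ n ℚ./ 1)) ⟩
  ℚ.toℚᵘ ((+ a ℚ./ suc b) ℚ.* (+ n ℚ./ 1))             ∎)
  where
  open ℚᵘ.≤-Reasoning
  integral : + c ℤ.* + (suc b * 1) ℤ.≤ (+ a ℤ.* + n) ℤ.* + 1
  integral = ℤ.≤-trans (ℤ.≤-reflexive lhs) (ℤ.≤-trans (ℤ.+≤+ bc≤an) (ℤ.≤-reflexive rhs))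
    where
    lhs : + c ℤ.* + (suc b * 1) ≡ + (suc b * c)
    lhs = trans (cong (λ m → + c ℤ.* + m) (ℕ.*-identityʳ (suc b)))
                (trans (sym (ℤ.pos-* c (suc b))) (cong +_ (ℕ.*-comm c (suc b))))
    rhs : + (a * n) ≡ (+ a ℤ.* + n) ℤ.* + 1
    rhs = trans (ℤ.pos-* a n) (sym (ℤ.*-identityʳ _))

J-co⁺ex-exists : ∀ n k → ∃ (IsCo⁺ex n (J (2 + k)))
J-co⁺ex-exists n k = co⁺ex-exists (J (2 + k)) (k * n)
  (triple zero (suc zero) (suc (suc zero)) , J-edge {2 + k} {zero} {suc zero} λ ())
  -- Since `d` is at most `suc k * d`, the upper bound also gives the crude bound `k * n` that
  -- limits the search.
  λ H free δ → ℕ.≤-trans (ℕ.m≤m+n _ _) (J-free⇒bound k H free δ)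

theorem16 : ∀ (k n : ℕ) .{{_ : NonTrivial k}} .{{_ : NonZero n}} →
    let instance
          k≢0 : NonZero k
          k≢0 = nonTrivial⇒nonZero k
          k∸1≢0 : NonZero (k ∸ 1)
          k∸1≢0 = nonTrivial⇒nonZero-∸1 k
    in
    Σ[ c ∈ ℕ ] IsCo⁺ex n (J k) c
      × (k ∸ 2) * (n / k) ≤ c
      × (+ c ℚ./ 1) ℚ.≤ (+ (k ∸ 2) ℚ./ (k ∸ 1)) ℚ.* (+ n ℚ./ 1)
theorem16 (suc (suc k)) n =
  -- The value `c` is attained by the `J`-free 3-graph `H`, so the upper bound for `H` is one for
  -- `c`.
  let (c , co@((H , free , δ) , _)) = J-co⁺ex-exists n k
  in c , co , lower-bound n k co , cross-multiply k k c n (J-free⇒bound k H free δ)
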